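{- For all $n\ge1$ and all $k$, the number of bi-increasing permutations $\pi\in{\cal S}_n$ with ${\sf dexc}(\pi)=k$ equals the number of bi-increasing permutations $\pi\in{\cal S}_n$ with ${\sf ddes}(\pi)=k$.
   Context: Permutations $\pi\in{\cal S}_n$ are written as words $\pi_1\cdots\pi_n$. An excedance of $\pi$ is an integer $i\in[n-1]$ with $\pi_i>i$; ${\sf E}(\pi)$ is the set of excedances and ${\sf dexc}(\pi)=\sum_{i\in{\sf E}(\pi)}(\pi_i-i)$. A descent is an $i\in[n-1]$ with $\pi_i>\pi_{i+1}$; ${\sf D}(\pi)$ is the set of descents and ${\sf ddes}(\pi)=\sum_{i\in{\sf D}(\pi)}(\pi_i-\pi_{i+1})$. ${\sf inv}(\pi)$ is the number of pairs $i<j$ with $\pi_i>\pi_j$. A permutation is bi-increasing if ${\sf inv}(\pi)={\sf dexc}(\pi)$. -}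

module Defs where

open import Data.Nat using (ℕ; zero; suc; _+_; _∸_; _<ᵇ_; _≡ᵇ_)
open import Data.Bool using (Bool; true; false; if_then_else_; _∧_; not)
open import Data.Fin using (Fin; toℕ)
open import Data.List using (List; []; _∷_; length; filter; concatMap; map; allFin)
open import Data.Nat.ListAction using (sum)
open import Data.Bool.ListAction using (and)
open import Data.Vec using (Vec; lookup)
import Data.Vec
import Data.List
import Data.Bool
import Data.Fin
open import Relation.Binary.PropositionalEquality using (_≡_)
open import Relation.Nullary.Decidable using (Dec)
open import Data.Nat using (_≟_)

-- Words of length n over the alphabet Fin n (letter j stands for value j+1,
-- position i : Fin n stands for index i+1).  All differences below are
-- invariant under this uniform shift by 1.

allVecs : (n m : ℕ) → List (Vec (Fin n) m)
allVecs n zero    = Data.Vec.[] ∷ []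
allVecs n (suc m) = concatMap (λ x → map (x Data.Vec.∷_) (allVecs n m)) (allFin n)

Σ[_]_ : (n : ℕ) → (Fin n → ℕ) → ℕ
Σ[ n ] f = sum (map f (allFin n))

isPerm : {n : ℕ} → Vec (Fin n) n → Bool
isPerm {n} w = and (concatMap (λ i → map (λ j →
  if toℕ i <ᵇ toℕ j then not (toℕ (lookup w i) ≡ᵇ toℕ (lookup w j)) else true)
  (allFin n)) (allFin n))

S : (n : ℕ) → List (Vec (Fin n) n)
S n = filter (λ w → Data.Bool._≟_ (isPerm w) true) (allVecs n n)

π[_] : {n : ℕ} → Vec (Fin n) n → Fin n → ℕ
π[ w ] i = toℕ (lookup w i)

inv : {n : ℕ} → Vec (Fin n) n → ℕ
inv {n} w = Σ[ n ] (λ i → Σ[ n ] (λ j →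
  if toℕ i <ᵇ toℕ j then (if π[ w ] j <ᵇ π[ w ] i then 1 else 0) else 0))

-- dexc(π) = Σ_{i : π_i > i} (π_i - i)
-- (i = n is never an excedance of a permutation, so summing over all i is the same
--  as summing over [n-1]; we nevertheless restrict to i < n-1 explicitly)
dexc : {n : ℕ} → Vec (Fin n) n → ℕ
dexc {n} w = Σ[ n ] (λ i →
  if suc (toℕ i) <ᵇ n then
    (if toℕ i <ᵇ π[ w ] i then π[ w ] i ∸ toℕ i else 0)
  else 0)

ddes : {n : ℕ} → Vec (Fin n) n → ℕ
ddes {zero} w = 0
ddes {suc n} w = Σ[ n ] (λ i →
  let a = toℕ (lookup w (Data.Fin.inject₁ i))
      b = toℕ (lookup w (Data.Fin.suc i))
  in if b <ᵇ a then a ∸ b else 0)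

biIncreasing : {n : ℕ} → Vec (Fin n) n → Bool
biIncreasing w = inv w ≡ᵇ dexc w

countBI : (n : ℕ) → (Vec (Fin n) n → ℕ) → ℕ → ℕ
countBI n stat k =
  length (filter (λ w → Data.Bool._≟_ (biIncreasing w ∧ (stat w ≡ᵇ k)) true) (S n))

{-# OPTIONS --safe #-}
module Submission where

open import Defs
open import Data.Nat using (ℕ; zero; suc; _+_; _*_; _∸_; _^_; _⊔_; _⊓_; _≤_; _<_; _≥_; _<ᵇ_; _≡ᵇ_; z≤n; s≤s; s≤s⁻¹; _≟_; _<?_)
open import Data.Nat.Properties
open import Algebra.Properties.CommutativeSemigroup +-commutativeSemigroup using (x∙yz≈y∙xz; interchange)
open import Data.Nat.Induction using (<-wellFounded; <-rec)
open import Data.Nat.ListAction using (sum)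
open import Data.Nat.ListAction.Properties using (sum-↭)
open import Induction.WellFounded using (Acc; acc)
open import Data.Bool using (Bool; true; false; if_then_else_; _∧_; not; T)
import Data.Bool
open import Data.Bool.ListAction using (and)
open import Data.Fin using (Fin; toℕ; fromℕ<)
import Data.Fin
open import Data.Fin.Properties using (toℕ<n; toℕ-injective; toℕ-fromℕ<; toℕ-inject₁)
open import Data.List using (List; []; _∷_; _++_; length; map; filter; concatMap; cartesianProductWith; upTo; applyUpTo; allFin; tabulate)
open import Data.List.Properties using (length-applyUpTo; map-applyUpTo; map-tabulate)
open import Data.List.Membership.Propositional using (_∈_)
open import Data.List.Membership.Propositional.Properties
open import Data.List.Relation.Binary.Permutation.Propositional using (_↭_; refl; prep; swap; trans; ↭-sym; ↭-trans)
open import Data.List.Relation.Binary.Permutation.Propositional.Properties using (∈-resp-↭; ↭-length; shift; map⁺)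
open import Data.List.Relation.Binary.Pointwise using (Pointwise; []; _∷_)
open import Data.List.Relation.Unary.All using (All; []; _∷_)
import Data.List.Relation.Unary.All as All
open import Data.List.Relation.Unary.Any using (here; there)
open import Data.List.Relation.Unary.AllPairs using ([]; _∷_)
open import Data.List.Relation.Unary.Unique.Propositional using (Unique)
import Data.List.Relation.Unary.Unique.Propositional.Properties as Unique
open import Data.Product using (∃; _×_; _,_; proj₁; proj₂)
open import Data.Sum using (_⊎_; inj₁; inj₂)
open import Data.Empty using (⊥; ⊥-elim)
open import Data.Vec using (Vec; lookup)
import Data.Vec
import Data.Vec.Properties
open import Function using (_∘_; id)
open import Relation.Binary.Definitions using (tri<; tri≈; tri>)
open import Relation.Binary.PropositionalEquality using (_≡_; _≢_; refl; sym; cong; cong₂; subst; subst₂; module ≡-Reasoning) renaming (trans to ≡-trans)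
open import Relation.Nullary using (¬_; yes; no; contradiction)
open import Relation.Nullary.Decidable using (Dec; _×-dec_)

-- Let r i be the number of j > i with π j < π i and l i the number of j < i with π j > π i.
-- Then r i + i = π i + l i, so inv = Σ r i and dexc = Σ max(r i - l i, 0), and these agree iff
-- no i has both r i and l i positive, that is, iff π avoids 321.
--
-- Foata's fundamental transformation turns the blocks of π that start at the left-to-right
-- maxima into cycles.  The resulting τ satisfies dexc τ = Σ max(x - τ x, 0) = ddes π.  As long as
-- two excedances, or two non-excedances, of τ form an inversion, exchange their values: the sets
-- of excedance positions and of excedance values, hence dexc, do not change, and the process ends
-- at a 321-avoiding σ with dexc σ = ddes π.  These two sets determine a 321-avoiding π: they tell
-- which letters are left-to-right maxima, and which of these are followed by a descent, and two
-- words with the same data cannot have a first difference.  So π ↦ σ is an injection of a finite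
-- set into itself, hence a bijection.

-- Counting along an injective relation on a finite list.

-- Pigeonhole by deletion: take the head of `xs` out of `ys`. Distinctness keeps the tail inside
-- what is left, and the length bound leaves nothing over at the end.
Unique-⊆⇒↭ : {A : Set} {xs ys : List A} → Unique xs → (∀ {z} → z ∈ xs → z ∈ ys) →
  length ys ≤ length xs → xs ↭ ys
Unique-⊆⇒↭ {xs = []} {[]} _ _ _ = refl
Unique-⊆⇒↭ {xs = x ∷ xs} {ys} (x∉xs ∷ uxs) sub len with ∈-∃++ (sub (here refl))
... | as , bs , refl = ↭-trans (prep x (Unique-⊆⇒↭ uxs sub′ len′)) (↭-sym (shift x as bs))
  where
  sub′ : ∀ {z} → z ∈ xs → z ∈ as ++ bs
  sub′ z∈xs with ∈-resp-↭ (shift x as bs) (sub (there z∈xs))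
  ... | here refl = contradiction refl (All.lookup x∉xs z∈xs)
  ... | there z∈  = z∈
  len′ : length (as ++ bs) ≤ length xs
  len′ = s≤s⁻¹ (subst (_≤ suc (length xs)) (↭-length (shift x as bs)) len)

module _ {A : Set} (p : A → Bool) where

  count : List A → ℕ
  count xs = length (filter (λ x → Data.Bool._≟_ (p x) true) xs)

  count-∷ : ∀ x xs → count (x ∷ xs) ≡ (if p x then 1 else 0) + count xs
  count-∷ x xs with p x
  ... | true  = refl
  ... | false = refl

  count-↭ : ∀ {xs ys} → xs ↭ ys → count xs ≡ count ys
  count-↭ refl = refl
  count-↭ (prep {xs} {ys} x r)
    rewrite count-∷ x xs | count-∷ x ys = cong (_ +_) (count-↭ r)
  count-↭ (swap {xs} {ys} x y r)
    rewrite count-∷ x (y ∷ xs) | count-∷ y xs | count-∷ y (x ∷ ys) | count-∷ x ys | count-↭ r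
    = x∙yz≈y∙xz (if p x then 1 else 0) (if p y then 1 else 0) (count ys)
  count-↭ (trans r s) = ≡-trans (count-↭ r) (count-↭ s)

count-∧ : {A : Set} (p q : A → Bool) (xs : List A) →
  count (λ x → p x ∧ q x) xs ≡ count q (filter (λ x → Data.Bool._≟_ (p x) true) xs)
count-∧ p q [] = refl
count-∧ p q (x ∷ xs) rewrite count-∷ (λ x → p x ∧ q x) x xs with p x
... | false = count-∧ p q xs
... | true  rewrite count-∷ q x (filter (λ x → Data.Bool._≟_ (p x) true) xs)
    = cong (_ +_) (count-∧ p q xs)

module _ {A : Set} (R : A → A → Set) (R-injective : ∀ {x y z} → R x z → R y z → x ≡ y) where

  choose : ∀ {xs ys} → (∀ {x} → x ∈ xs → ∃ λ z → z ∈ ys × R x z) →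
    ∃ λ zs → Pointwise R xs zs × All (_∈ ys) zs
  choose {[]} _ = [] , [] , []
  choose {x ∷ xs} h with h (here refl) | choose {xs} (h ∘ there)
  ... | z , z∈ , r | zs , rs , zs∈ = z ∷ zs , r ∷ rs , z∈ ∷ zs∈

  Pointwise-Unique : ∀ {xs zs} → Pointwise R xs zs → Unique xs → Unique zs
  Pointwise-Unique [] [] = []
  Pointwise-Unique (r ∷ rs) (x∉ ∷ u) = distinct r rs x∉ ∷ Pointwise-Unique rs u
    where
    distinct : ∀ {x z xs zs} → R x z → Pointwise R xs zs → All (x ≢_) xs → All (z ≢_) zs
    distinct r [] [] = []
    distinct r (s ∷ rs) (x≢ ∷ x∉) = (λ { refl → x≢ (R-injective r s) }) ∷ distinct r rs x∉

  -- The chosen partners are distinct, lie in `xs` and are as many as `xs`, so they are a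
  -- rearrangement of `xs`. This avoids constructing an inverse map.
  count-transport : (p q : A → Bool) → (∀ {x z} → R x z → q x ≡ p z) → ∀ {xs} → Unique xs →
    (∀ {x} → x ∈ xs → ∃ λ z → z ∈ xs × R x z) → count p xs ≡ count q xs
  count-transport p q R⇒≡ {xs} u h with choose h
  ... | zs , rs , zs∈ = ≡-trans (count-↭ p (↭-sym zs↭xs)) (count-Pointwise rs)
    where
    Pointwise-length : ∀ {xs zs} → Pointwise R xs zs → length xs ≡ length zs
    Pointwise-length [] = refl
    Pointwise-length (_ ∷ rs) = cong suc (Pointwise-length rs)
    zs↭xs : zs ↭ xs
    zs↭xs = Unique-⊆⇒↭ (Pointwise-Unique rs u) (All.lookup zs∈) (≤-reflexive (Pointwise-length rs))
    count-Pointwise : ∀ {xs zs} → Pointwise R xs zs → count p zs ≡ count q xs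
    count-Pointwise [] = refl
    count-Pointwise {x ∷ xs} {z ∷ zs} (r ∷ rs)
      rewrite count-∷ p z zs | count-∷ q x xs | R⇒≡ r = cong (_ +_) (count-Pointwise rs)

-- Boolean comparisons and finite sums.

<⇒<ᵇ≡true : ∀ {m n} → m < n → (m <ᵇ n) ≡ true
<⇒<ᵇ≡true {m} {n} m<n with m <ᵇ n in eq
... | true  = refl
... | false = ⊥-elim (subst T eq (<⇒<ᵇ m<n))

≥⇒<ᵇ≡false : ∀ {m n} → n ≤ m → (m <ᵇ n) ≡ false
≥⇒<ᵇ≡false {m} {n} n≤m with m <ᵇ n in eq
... | false = refl
... | true  = contradiction (<ᵇ⇒< m n (subst T (sym eq) _)) (≤⇒≯ n≤m)

<ᵇ≡true⇒< : ∀ m n → (m <ᵇ n) ≡ true → m < n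
<ᵇ≡true⇒< m n eq = <ᵇ⇒< m n (subst T (sym eq) _)

<ᵇ≡false⇒≥ : ∀ m n → (m <ᵇ n) ≡ false → n ≤ m
<ᵇ≡false⇒≥ m n eq = ≮⇒≥ λ m<n → subst T eq (<⇒<ᵇ m<n)

if-<ᵇ-∸ : ∀ a b → (if b <ᵇ a then a ∸ b else 0) ≡ a ∸ b
if-<ᵇ-∸ a b with b <ᵇ a in eq
... | true  = refl
... | false = sym (m≤n⇒m∸n≡0 (<ᵇ≡false⇒≥ b a eq))

𝟙 : Bool → ℕ
𝟙 b = if b then 1 else 0

∑ : ℕ → (ℕ → ℕ) → ℕ
∑ zero    g = 0
∑ (suc n) g = g 0 + ∑ n (g ∘ suc)

∑-cong : ∀ n {g h} → (∀ {i} → i < n → g i ≡ h i) → ∑ n g ≡ ∑ n h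
∑-cong zero    eq = refl
∑-cong (suc n) eq = cong₂ _+_ (eq (s≤s z≤n)) (∑-cong n (eq ∘ s≤s))

∑-+ : ∀ n g h → ∑ n (λ i → g i + h i) ≡ ∑ n g + ∑ n h
∑-+ zero    g h = refl
∑-+ (suc n) g h rewrite ∑-+ n (g ∘ suc) (h ∘ suc) =
  interchange (g 0) (h 0) (∑ n (g ∘ suc)) (∑ n (h ∘ suc))

∑-snoc : ∀ n g → ∑ (suc n) g ≡ ∑ n g + g n
∑-snoc zero    g = +-identityʳ (g 0)
∑-snoc (suc n) g = ≡-trans (cong (g 0 +_) (∑-snoc n (g ∘ suc))) (sym (+-assoc (g 0) _ _))

∑-mono-≤ : ∀ n {g h} → (∀ {i} → i < n → g i ≤ h i) → ∑ n g ≤ ∑ n h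
∑-mono-≤ zero    le = z≤n
∑-mono-≤ (suc n) le = +-mono-≤ (le (s≤s z≤n)) (∑-mono-≤ n (le ∘ s≤s))

-- A strict gain of `h` over `g` at one index could not be offset at another.
∑-≤-equality : ∀ n {g h} → (∀ {i} → i < n → g i ≤ h i) → ∑ n h ≤ ∑ n g →
  ∀ {i} → i < n → h i ≤ g i
∑-≤-equality (suc n) {g} {h} le hg {zero} _ =
  +-cancelʳ-≤ (∑ n (g ∘ suc)) (h 0) (g 0) (≤-trans (+-monoʳ-≤ (h 0) (∑-mono-≤ n (le ∘ s≤s))) hg)
∑-≤-equality (suc n) {g} {h} le hg {suc i} (s≤s i<n) =
  ∑-≤-equality n (le ∘ s≤s)
    (+-cancelˡ-≤ (g 0) _ _ (≤-trans (+-monoˡ-≤ _ (le (s≤s z≤n))) hg)) i<n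

term≤∑ : ∀ n g {i} → i < n → g i ≤ ∑ n g
term≤∑ (suc n) g {zero}  _         = m≤m+n _ _
term≤∑ (suc n) g {suc i} (s≤s i<n) = ≤-trans (term≤∑ n (g ∘ suc) i<n) (m≤n+m _ (g 0))

∑-zero-or-witness : ∀ n g → ∑ n g ≡ 0 ⊎ (∃ λ i → i < n × g i ≢ 0)
∑-zero-or-witness zero g = inj₁ refl
∑-zero-or-witness (suc n) g with g 0 ≟ 0 | ∑-zero-or-witness n (g ∘ suc)
... | no  g0≢0 | _                     = inj₂ (0 , s≤s z≤n , g0≢0)
... | yes _    | inj₂ (i , i<n , gi≢0) = inj₂ (suc i , s≤s i<n , gi≢0)
... | yes g0≡0 | inj₁ eq               = inj₁ (cong₂ _+_ g0≡0 eq)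

∑-below : ∀ n {v} → v ≤ n → ∑ n (λ y → 𝟙 (y <ᵇ v)) ≡ v
∑-below zero z≤n = refl
∑-below (suc n) z≤n = ∑-below n z≤n
∑-below (suc n) (s≤s v≤n) = cong suc (∑-below n v≤n)

∑≡sum-applyUpTo : ∀ n g → ∑ n g ≡ sum (applyUpTo g n)
∑≡sum-applyUpTo zero    g = refl
∑≡sum-applyUpTo (suc n) g = cong (g 0 +_) (∑≡sum-applyUpTo n (g ∘ suc))

Σ≡∑ : ∀ n {f : Fin n → ℕ} {g : ℕ → ℕ} → (∀ i → f i ≡ g (toℕ i)) → Σ[ n ] f ≡ ∑ n g
Σ≡∑ n {f} {g} eq = ≡-trans (cong sum (map-tabulate id f)) (go n eq)
  where
  go : ∀ n {f : Fin n → ℕ} {g : ℕ → ℕ} → (∀ i → f i ≡ g (toℕ i)) → sum (tabulate f) ≡ ∑ n g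
  go zero    eq = refl
  go (suc n) eq = cong₂ _+_ (eq Data.Fin.zero) (go n (eq ∘ Data.Fin.suc))

-- Permutations of an initial segment of the natural numbers.

-- The function is total on `ℕ` but constrained only below `n`, so that `f (suc i)` and even `f n`
-- can be written without coercions between finite types.
record Perm (n : ℕ) (f : ℕ → ℕ) : Set where
  field
    bounded   : ∀ {i} → i < n → f i < n
    injective : ∀ {i j} → i < n → j < n → f i ≡ f j → i ≡ j

module PermProperties {n : ℕ} {f : ℕ → ℕ} (P : Perm n f) where
  open Perm P

  applyUpTo-↭ : applyUpTo f n ↭ upTo n
  applyUpTo-↭ = Unique-⊆⇒↭
    (Unique.applyUpTo⁺₁ f n λ i<j j<n eq → <⇒≢ i<j (injective (<-trans i<j j<n) j<n eq))
    (λ z∈ → case-∈ (∈-applyUpTo⁻ f z∈))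
    (≤-reflexive (≡-trans (length-applyUpTo id n) (sym (length-applyUpTo f n))))
    where
    case-∈ : ∀ {z} → (∃ λ i → i < n × z ≡ f i) → z ∈ upTo n
    case-∈ (i , i<n , refl) = ∈-upTo⁺ (bounded i<n)

  surjective : ∀ {y} → y < n → ∃ λ x → x < n × f x ≡ y
  surjective y<n with ∈-applyUpTo⁻ f (∈-resp-↭ (↭-sym applyUpTo-↭) (∈-upTo⁺ y<n))
  ... | x , x<n , eq = x , x<n , sym eq

  ∑-reindex : ∀ g → ∑ n (g ∘ f) ≡ ∑ n g
  ∑-reindex g = begin
    ∑ n (g ∘ f)                ≡⟨ ∑≡sum-applyUpTo n (g ∘ f) ⟩
    sum (applyUpTo (g ∘ f) n)  ≡⟨ cong sum (map-applyUpTo f g n) ⟨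
    sum (map g (applyUpTo f n)) ≡⟨ sum-↭ (map⁺ g applyUpTo-↭) ⟩
    sum (map g (upTo n))       ≡⟨ cong sum (map-applyUpTo id g n) ⟩
    sum (applyUpTo g n)        ≡⟨ ∑≡sum-applyUpTo n g ⟨
    ∑ n g                      ∎
    where open ≡-Reasoning

  inverse : ℕ → ℕ
  inverse y with y <? n
  ... | yes y<n = proj₁ (surjective y<n)
  -- Arbitrary value: the lemmas on `inverse` only speak of arguments below `n`.
  ... | no  _   = 0

  inverse-bounded : ∀ {y} → y < n → inverse y < n
  inverse-bounded {y} y<n with y <? n
  ... | yes p = proj₁ (proj₂ (surjective p))
  ... | no ¬p = contradiction y<n ¬p

  f∘inverse : ∀ {y} → y < n → f (inverse y) ≡ y
  f∘inverse {y} y<n with y <? n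
  ... | yes p = proj₂ (proj₂ (surjective p))
  ... | no ¬p = contradiction y<n ¬p

  inverse∘f : ∀ {x} → x < n → inverse (f x) ≡ x
  inverse∘f x<n = injective (inverse-bounded (bounded x<n)) x<n (f∘inverse (bounded x<n))

  inverse-Perm : Perm n inverse
  inverse-Perm = record
    { bounded   = inverse-bounded
    ; injective = λ i<n j<n eq → ≡-trans (sym (f∘inverse i<n)) (≡-trans (cong f eq) (f∘inverse j<n))
    }

-- Bi-increasing means 321-avoiding

Av321 : ℕ → (ℕ → ℕ) → Set
Av321 n f = ∀ {a b c} → a < b → b < c → c < n → f b < f a → f c < f b → ⊥

smallerAfter greaterBefore : (ℕ → ℕ) → ℕ → ℕ → ℕ
smallerAfter  f i j = if i <ᵇ j then 𝟙 (f j <ᵇ f i) else 0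
greaterBefore f i j = if j <ᵇ i then 𝟙 (f i <ᵇ f j) else 0

inversions : ℕ → (ℕ → ℕ) → ℕ
inversions n f = ∑ n λ i → ∑ n (smallerAfter f i)

excess : ℕ → (ℕ → ℕ) → ℕ
excess n f = ∑ n λ i → f i ∸ i

module _ {n : ℕ} {f : ℕ → ℕ} (P : Perm n f) where
  open Perm P
  open PermProperties P

  private
    r l : ℕ → ℕ
    r i = ∑ n (smallerAfter f i)
    l i = ∑ n (greaterBefore f i)

    -- Both sides are the indicator of `j < i` or `f j < f i`.
    pointwise : ∀ {i j} → i < n → j < n →
      smallerAfter f i j + 𝟙 (j <ᵇ i) ≡ 𝟙 (f j <ᵇ f i) + greaterBefore f i j
    pointwise {i} {j} i<n j<n with <-cmp j i
    ... | tri≈ _ refl _ rewrite ≥⇒<ᵇ≡false (≤-refl {i}) | ≥⇒<ᵇ≡false (≤-refl {f i}) = refl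
    ... | tri> _ _ i<j rewrite <⇒<ᵇ≡true i<j | ≥⇒<ᵇ≡false (<⇒≤ i<j) = refl
    ... | tri< j<i _ _ rewrite <⇒<ᵇ≡true j<i | ≥⇒<ᵇ≡false (<⇒≤ j<i) with <-cmp (f j) (f i)
    ...   | tri< p _ _ rewrite <⇒<ᵇ≡true p | ≥⇒<ᵇ≡false (<⇒≤ p) = refl
    ...   | tri> _ _ p rewrite <⇒<ᵇ≡true p | ≥⇒<ᵇ≡false (<⇒≤ p) = refl
    ...   | tri≈ _ p _ = contradiction (injective j<n i<n p) (<⇒≢ j<i)

    -- Sum `pointwise` over `j`: exactly `i` positions precede `i`, and exactly `f i` positions
    -- carry a value below `f i` because `f` is a permutation.
    balance : ∀ {i} → i < n → r i + i ≡ f i + l i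
    balance {i} i<n = begin
      r i + i                                           ≡⟨ cong (r i +_) (∑-below n (<⇒≤ i<n)) ⟨
      r i + ∑ n (λ j → 𝟙 (j <ᵇ i))                      ≡⟨ ∑-+ n _ _ ⟨
      ∑ n (λ j → smallerAfter f i j + 𝟙 (j <ᵇ i))       ≡⟨ ∑-cong n (pointwise i<n) ⟩
      ∑ n (λ j → 𝟙 (f j <ᵇ f i) + greaterBefore f i j)  ≡⟨ ∑-+ n _ _ ⟩
      ∑ n (λ j → 𝟙 (f j <ᵇ f i)) + l i                  ≡⟨ cong (_+ l i) (∑-reindex (λ y → 𝟙 (y <ᵇ f i))) ⟩
      ∑ n (λ y → 𝟙 (y <ᵇ f i)) + l i                    ≡⟨ cong (_+ l i) (∑-below n (<⇒≤ (bounded i<n))) ⟩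
      f i + l i                                         ∎
      where open ≡-Reasoning

    f∸i≡r∸l : ∀ {i} → i < n → f i ∸ i ≡ r i ∸ l i
    f∸i≡r∸l {i} i<n = begin
      f i ∸ i                  ≡⟨ [m+n]∸[m+o]≡n∸o (l i) (f i) i ⟨
      (l i + f i) ∸ (l i + i)  ≡⟨ cong₂ _∸_ (≡-trans (+-comm (l i) (f i)) (sym (balance i<n))) (+-comm (l i) i) ⟩
      (r i + i) ∸ (i + l i)    ≡⟨ cong (_∸ (i + l i)) (+-comm (r i) i) ⟩
      (i + r i) ∸ (i + l i)    ≡⟨ [m+n]∸[m+o]≡n∸o i (r i) (l i) ⟩
      r i ∸ l i                ∎
      where open ≡-Reasoning

  -- Each term `f i ∸ i`, being `r i ∸ l i`, is at most `r i`, so equal sums force equality at every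
  -- index. At the middle of a 321 pattern `r` and `l` are both positive, and the inequality would
  -- be strict.
  inversions≡excess⇒Av321 : inversions n f ≡ excess n f → Av321 n f
  inversions≡excess⇒Av321 eq {a} {b} {c} a<b b<c c<n fb<fa fc<fb =
    <⇒≱ (∸-monoʳ-< {r b} {l b} {0} 0<l l≤r) (≤-trans r≤ (≤-reflexive (f∸i≡r∸l b<n)))
    where
    b<n : b < n
    b<n = <-trans b<c c<n
    r≤ : r b ≤ f b ∸ b
    r≤ = ∑-≤-equality n {λ i → f i ∸ i} {r}
      (λ {i} i<n → ≤-trans (≤-reflexive (f∸i≡r∸l i<n)) (m∸n≤m (r i) (l i)))
      (≤-reflexive eq) b<n
    0<l : 0 < l b
    0<l = ≤-trans (≤-reflexive (sym eq₁)) (term≤∑ n (greaterBefore f b) (<-trans a<b b<n))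
      where
      eq₁ : greaterBefore f b a ≡ 1
      eq₁ rewrite <⇒<ᵇ≡true a<b | <⇒<ᵇ≡true fb<fa = refl
    0<r : 0 < r b
    0<r = ≤-trans (≤-reflexive (sym eq₁)) (term≤∑ n (smallerAfter f b) c<n)
      where
      eq₁ : smallerAfter f b c ≡ 1
      eq₁ rewrite <⇒<ᵇ≡true b<c | <⇒<ᵇ≡true fc<fb = refl
    l≤r : l b ≤ r b
    l≤r with ≤-total (l b) (r b)
    ... | inj₁ p = p
    ... | inj₂ p = contradiction
      (≤-trans r≤ (≤-reflexive (≡-trans (f∸i≡r∸l b<n) (m≤n⇒m∸n≡0 p)))) (<⇒≱ 0<r)

  Av321⇒inversions≡excess : Av321 n f → inversions n f ≡ excess n f
  Av321⇒inversions≡excess av = ∑-cong n λ i<n → ≡-trans (r≡r∸l i<n) (sym (f∸i≡r∸l i<n))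
    where
    if-≢0 : ∀ {p q} → (if p then 𝟙 q else 0) ≢ 0 → p ≡ true × q ≡ true
    if-≢0 {true} {true}  _ = refl , refl
    if-≢0 {true} {false} h = contradiction refl h
    if-≢0 {false}        h = contradiction refl h
    r≡r∸l : ∀ {i} → i < n → r i ≡ r i ∸ l i
    r≡r∸l {i} i<n with ∑-zero-or-witness n (smallerAfter f i) | ∑-zero-or-witness n (greaterBefore f i)
    ... | inj₁ r≡0 | _        rewrite r≡0 = sym (0∸n≡0 (l i))
    ... | inj₂ _   | inj₁ l≡0 rewrite l≡0 = refl
    ... | inj₂ (c , c<n , hc) | inj₂ (a , a<n , ha) with if-≢0 {i <ᵇ c} hc | if-≢0 {a <ᵇ i} ha
    ...   | i<c , fc<fi | a<i , fi<fa = ⊥-elim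
      (av (<ᵇ≡true⇒< a i a<i) (<ᵇ≡true⇒< i c i<c) c<n (<ᵇ≡true⇒< (f i) (f a) fi<fa) (<ᵇ≡true⇒< (f c) (f i) fc<fi))

-- Uncrossing

-- e is the indicator of the excedance positions of f, and v that of the excedance values.
ExcedanceType : ℕ → (e v : ℕ → Bool) → (ℕ → ℕ) → Set
ExcedanceType n e v f = ∀ {x} → x < n → (x <ᵇ f x) ≡ e x × v (f x) ≡ e x

-- The excess is the sum of the excedance values minus the sum `E` of the excedance positions, and
-- `e` and `v` fix both sums. Adding `E` avoids truncated subtraction.
excess-determined : ∀ {n e v f g} → Perm n f → Perm n g →
  ExcedanceType n e v f → ExcedanceType n e v g → excess n f ≡ excess n g
excess-determined {n} {e} {v} {f} {g} Pf Pg tf tg = +-cancelʳ-≡ E _ _ (≡-trans (step Pf tf) (sym (step Pg tg)))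
  where
  E : ℕ
  E = ∑ n λ x → if e x then x else 0
  step : ∀ {h} → Perm n h → ExcedanceType n e v h →
    excess n h + E ≡ ∑ n (λ y → if v y then y else 0)
  step {h} P t = ≡-trans (sym (∑-+ n _ _)) (≡-trans (∑-cong n term) (PermProperties.∑-reindex P (λ y → if v y then y else 0)))
    where
    term : ∀ {x} → x < n → (h x ∸ x) + (if e x then x else 0) ≡ (if v (h x) then h x else 0)
    term {x} x<n rewrite proj₂ (t x<n) with e x | proj₁ (t x<n)
    ... | true  | eq = m∸n+n≡m (<⇒≤ (<ᵇ≡true⇒< x (h x) eq))
    ... | false | eq = ≡-trans (+-identityʳ _) (m≤n⇒m∸n≡0 (<ᵇ≡false⇒≥ x (h x) eq))

-- The graph of a transposition as a datatype, so that matching replaces case distinctions on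
-- equality of numbers.
data Transposes (a b : ℕ) : ℕ → ℕ → Set where
  first  : Transposes a b a b
  second : Transposes a b b a
  other  : ∀ {x} → x ≢ a → x ≢ b → Transposes a b x x

transposes : ∀ a b x → ∃ (Transposes a b x)
transposes a b x with x ≟ a | x ≟ b
... | yes refl | _        = b , first
... | no _     | yes refl = a , second
... | no x≢a   | no x≢b   = x , other x≢a x≢b

transpose : ℕ → ℕ → ℕ → ℕ
transpose a b x = proj₁ (transposes a b x)

transposes-injective : ∀ {a b x y z} → Transposes a b x z → Transposes a b y z → x ≡ y
transposes-injective first         first         = refl
transposes-injective first         second        = refl
transposes-injective first         (other _ y≢b) = contradiction refl y≢b
transposes-injective second        first         = refl
transposes-injective second        second        = refl
transposes-injective second        (other y≢a _) = contradiction refl y≢a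
transposes-injective (other _ x≢b) first         = contradiction refl x≢b
transposes-injective (other x≢a _) second        = contradiction refl x≢a
transposes-injective (other _ _)   (other _ _)   = refl

transpose-Perm : ∀ {n a b f} → a < n → b < n → Perm n f → Perm n (f ∘ transpose a b)
transpose-Perm {n} {a} {b} {f} a<n b<n P = record
  { bounded   = λ i<n → bounded (t<n (proj₂ (transposes a b _)) i<n)
  ; injective = λ {i} {j} i<n j<n eq → transposes-injective (proj₂ (transposes a b i))
      (subst (Transposes a b j) (sym (injective (t<n (proj₂ (transposes a b i)) i<n) (t<n (proj₂ (transposes a b j)) j<n) eq))
        (proj₂ (transposes a b j)))
  }
  where
  open Perm P
  t<n : ∀ {x y} → Transposes a b x y → x < n → y < n
  t<n first       _   = b<n
  t<n second      _   = a<n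
  t<n (other _ _) x<n = x<n

-- The number with base-B digits f 0, …, f (n - 1), so that comparing values is comparing
-- words lexicographically.
digits : ℕ → ℕ → (ℕ → ℕ) → ℕ
digits B zero    f = 0
digits B (suc n) f = f 0 * B ^ n + digits B n (f ∘ suc)

digits-bounded : ∀ B n {f} → (∀ {i} → i < n → f i < B) → digits B n f < B ^ n
digits-bounded B zero    f<B = s≤s z≤n
digits-bounded B (suc n) {f} f<B = begin-strict
  f 0 * B ^ n + digits B n (f ∘ suc)  <⟨ +-monoʳ-< (f 0 * B ^ n) (digits-bounded B n (f<B ∘ s≤s)) ⟩
  f 0 * B ^ n + B ^ n                 ≡⟨ +-comm (f 0 * B ^ n) (B ^ n) ⟩
  suc (f 0) * B ^ n                   ≤⟨ *-monoˡ-≤ (B ^ n) (f<B (s≤s z≤n)) ⟩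
  B * B ^ n                           ∎
  where open ≤-Reasoning

-- All digits of `f` after the first difference are together worth less than one unit of the
-- differing digit.
digits-lex : ∀ B n {f g a} → a < n → (∀ {i} → i < n → f i < B) →
  (∀ {i} → i < a → f i ≡ g i) → f a < g a → digits B n f < digits B n g
digits-lex B (suc n) {f} {g} {zero} _ f<B _ fa<ga = begin-strict
  f 0 * B ^ n + digits B n (f ∘ suc)  <⟨ +-monoʳ-< (f 0 * B ^ n) (digits-bounded B n (f<B ∘ s≤s)) ⟩
  f 0 * B ^ n + B ^ n                 ≡⟨ +-comm (f 0 * B ^ n) (B ^ n) ⟩
  suc (f 0) * B ^ n                   ≤⟨ *-monoˡ-≤ (B ^ n) fa<ga ⟩
  g 0 * B ^ n                         ≤⟨ m≤m+n _ _ ⟩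
  g 0 * B ^ n + digits B n (g ∘ suc)  ∎
  where open ≤-Reasoning
digits-lex B (suc n) {f} {g} {suc a} (s≤s a<n) f<B eq fa<ga rewrite eq (s≤s (z≤n {a})) =
  +-monoʳ-< (g 0 * B ^ n) (digits-lex B n a<n (f<B ∘ s≤s) (eq ∘ s≤s) fa<ga)

module _ {n : ℕ} {e v : ℕ → Bool} where

  Crossing : (ℕ → ℕ) → ℕ → ℕ → Set
  Crossing f a b = a < b × f b < f a × e a ≡ e b

  -- In a 321 pattern the middle position crosses one of the outer two. If `b` is an excedance, so
  -- is `a`, since `a < b < f b < f a`. Otherwise `c` is none either, since `f c < f b ≤ b < c`.
  uncrossed⇒Av321 : ∀ {f} → ExcedanceType n e v f →
    ¬ (∃ λ a → a < n × ∃ λ b → b < n × Crossing f a b) → Av321 n f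
  uncrossed⇒Av321 {f} t none {a} {b} {c} a<b b<c c<n fb<fa fc<fb with e b in eq
  ... | true  = none (a , <-trans a<b b<n , b , b<n , a<b , fb<fa , ≡-trans ea (sym eq))
    where
    b<n : b < n
    b<n = <-trans b<c c<n
    ea : e a ≡ true
    ea = ≡-trans (sym (proj₁ (t (<-trans a<b b<n))))
      (<⇒<ᵇ≡true (<-trans a<b (<-trans (<ᵇ≡true⇒< b (f b) (≡-trans (proj₁ (t b<n)) eq)) fb<fa)))
  ... | false = none (b , b<n , c , c<n , b<c , fc<fb , ≡-trans eq (sym ec))
    where
    b<n : b < n
    b<n = <-trans b<c c<n
    ec : e c ≡ false
    ec = ≡-trans (sym (proj₁ (t c<n)))
      (≥⇒<ᵇ≡false (≤-trans (<⇒≤ fc<fb) (≤-trans (<ᵇ≡false⇒≥ b (f b) (≡-trans (proj₁ (t b<n)) eq)) (<⇒≤ b<c))))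

  -- For two excedances `a < b < f b < f a`, and for two non-excedances `f b < f a ≤ a < b`. Either
  -- way both values lie on the same side of both positions, so the exchange changes no status.
  uncross-type : ∀ {f a b} → a < n → b < n → ExcedanceType n e v f → Crossing f a b →
    ExcedanceType n e v (f ∘ transpose a b)
  uncross-type {f} {a} {b} a<n b<n t (a<b , fb<fa , ea≡eb) {x} x<n = go (proj₂ (transposes a b x)) x<n
    where
    go : ∀ {x y} → Transposes a b x y → x < n → (x <ᵇ f y) ≡ e x × v (f y) ≡ e x
    go (other _ _) x<n = t x<n
    go first _ = lemma , ≡-trans (proj₂ (t b<n)) (sym ea≡eb)
      where
      lemma : (a <ᵇ f b) ≡ e a
      lemma with e a in eq
      ... | true  = <⇒<ᵇ≡true (<-trans a<b (<ᵇ≡true⇒< b (f b) (≡-trans (proj₁ (t b<n)) (sym ea≡eb))))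
      ... | false = ≥⇒<ᵇ≡false (≤-trans (<⇒≤ fb<fa) (<ᵇ≡false⇒≥ a (f a) (≡-trans (proj₁ (t a<n)) eq)))
    go second _ = lemma , ≡-trans (proj₂ (t a<n)) ea≡eb
      where
      lemma : (b <ᵇ f a) ≡ e b
      lemma with e b in eq
      ... | true  = <⇒<ᵇ≡true (<-trans (<ᵇ≡true⇒< b (f b) (≡-trans (proj₁ (t b<n)) eq)) fb<fa)
      ... | false = ≥⇒<ᵇ≡false (≤-trans (<ᵇ≡false⇒≥ a (f a) (≡-trans (proj₁ (t a<n)) ea≡eb)) (<⇒≤ a<b))

  -- The first position to change is `a`, and it receives the smaller value `f b`.
  uncross-decreases : ∀ {f a b} → a < n → b < n → Perm n f → Crossing f a b →
    digits n n (f ∘ transpose a b) < digits n n f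
  uncross-decreases {f} {a} {b} a<n b<n P (a<b , fb<fa , _) =
    digits-lex n n {f ∘ transpose a b} {f} a<n (Perm.bounded (transpose-Perm a<n b<n P))
      (λ {i} i<a → cong f (fixed (proj₂ (transposes a b i)) i<a))
      (subst (λ y → f y < f a) (sym (moved (proj₂ (transposes a b a)) refl)) fb<fa)
    where
    fixed : ∀ {i y} → Transposes a b i y → i < a → y ≡ i
    fixed first       a<a = contradiction a<a (<-irrefl refl)
    fixed second      b<a = contradiction b<a (<-asym a<b)
    fixed (other _ _) _   = refl
    moved : ∀ {i y} → Transposes a b i y → i ≡ a → y ≡ b
    moved first         _   = refl
    moved second        eq  = sym eq
    moved (other i≢a _) i≡a = contradiction i≡a i≢a

  exists-Av321-of-type : ∀ {f} → Perm n f → ExcedanceType n e v f →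
    ∃ λ g → Perm n g × ExcedanceType n e v g × Av321 n g
  exists-Av321-of-type {f} P t = go P t (<-wellFounded (digits n n f))
    where
    crossing? : ∀ f a b → Dec (Crossing f a b)
    crossing? f a b = a <? b ×-dec f b <? f a ×-dec Data.Bool._≟_ (e a) (e b)
    go : ∀ {f} → Perm n f → ExcedanceType n e v f → Acc _<_ (digits n n f) →
      ∃ λ g → Perm n g × ExcedanceType n e v g × Av321 n g
    go {f} P t (acc rs) with anyUpTo? (λ a → anyUpTo? (crossing? f a) n) n
    ... | no none = f , P , t , uncrossed⇒Av321 t none
    ... | yes (a , a<n , b , b<n , c) = go (transpose-Perm a<n b<n P)
      (uncross-type {f} a<n b<n t c) (rs (uncross-decreases a<n b<n P c))

-- Foata's transformation

prefixMax : (ℕ → ℕ) → ℕ → ℕ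
prefixMax f zero    = f 0
prefixMax f (suc i) = prefixMax f i ⊔ f (suc i)

prefixMax-upper : ∀ f {k i} → k ≤ i → f k ≤ prefixMax f i
prefixMax-upper f {zero} {zero} z≤n = ≤-refl
prefixMax-upper f {k} {suc i} k≤1+i with m≤n⇒m<n∨m≡n k≤1+i
... | inj₁ (s≤s k≤i) = ≤-trans (prefixMax-upper f k≤i) (m≤m⊔n _ _)
... | inj₂ refl      = m≤n⊔m (prefixMax f i) _

prefixMax-attained : ∀ f i → ∃ λ k → k ≤ i × f k ≡ prefixMax f i
prefixMax-attained f zero = 0 , z≤n , refl
prefixMax-attained f (suc i) with ⊔-sel (prefixMax f i) (f (suc i)) | prefixMax-attained f i
... | inj₁ eq | k , k≤i , eq′ = k , m≤n⇒m≤1+n k≤i , ≡-trans eq′ (sym eq)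
... | inj₂ eq | _             = suc i , ≤-refl , sym eq

prefixMax-mono : ∀ f {i j} → i ≤ j → prefixMax f i ≤ prefixMax f j
prefixMax-mono f {i} i≤j with prefixMax-attained f i
... | k , k≤i , eq = ≤-trans (≤-reflexive (sym eq)) (prefixMax-upper f (≤-trans k≤i i≤j))

prefixMax-cong : ∀ {f g} i → (∀ {k} → k ≤ i → f k ≡ g k) → prefixMax f i ≡ prefixMax g i
prefixMax-cong zero    eq = eq z≤n
prefixMax-cong (suc i) eq = cong₂ _⊔_ (prefixMax-cong i (eq ∘ m≤n⇒m≤1+n)) (eq ≤-refl)

<-prefixMax-suc : ∀ f {i} → f (suc i) < prefixMax f (suc i) → f (suc i) < prefixMax f i
<-prefixMax-suc f {i} p with ⊔-sel (prefixMax f i) (f (suc i))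
... | inj₁ eq = subst (f (suc i) <_) eq p
... | inj₂ eq = contradiction p (<-irrefl (sym eq))

-- The value of Foata's fundamental transformation at f i: the cycles are the blocks of the word
-- that start at its left-to-right maxima.
foata : (ℕ → ℕ) → ℕ → ℕ
foata f i = f (suc i) ⊓ prefixMax f i

-- The convention f n = n makes the end of the word behave like the start of a block.
record Word (n : ℕ) (f : ℕ → ℕ) : Set where
  field
    perm : Perm n f
    end  : f n ≡ n
  open Perm perm public
  open PermProperties perm public

  injective-≤ : ∀ {i j} → i ≤ n → j ≤ n → f i ≡ f j → i ≡ j
  injective-≤ i≤n j≤n eq with m≤n⇒m<n∨m≡n i≤n | m≤n⇒m<n∨m≡n j≤n
  ... | inj₁ i<n  | inj₁ j<n  = injective i<n j<n eq
  ... | inj₂ refl | inj₂ refl = refl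
  ... | inj₁ i<n  | inj₂ refl = contradiction (≡-trans eq end) (<⇒≢ (bounded i<n))
  ... | inj₂ refl | inj₁ j<n  = contradiction (≡-trans (sym eq) end) (<⇒≢ (bounded j<n))

  prefixMax-bounded : ∀ {i} → i < n → prefixMax f i < n
  prefixMax-bounded {i} i<n with prefixMax-attained f i
  ... | k , k≤i , eq = subst (_< n) eq (bounded (≤-<-trans k≤i i<n))

  -- The closing letter `f n = n` exceeds every earlier maximum.
  <prefixMax⇒<n : ∀ {i} → i < n → f (suc i) < prefixMax f i → suc i < n
  <prefixMax⇒<n i<n p with m≤n⇒m<n∨m≡n i<n
  ... | inj₁ q    = q
  ... | inj₂ refl = contradiction (<-trans p (prefixMax-bounded i<n)) (<-irrefl end)

  -- A value of `foata f` is the next letter, if the block continues, and otherwise the maximum of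
  -- the block that ends. Next letters are distinct from each other and from these maxima, and two
  -- blocks that end at `i < j` have different maxima because the letter after the first block
  -- exceeds its maximum.
  foata-≢ : ∀ {i j} → i < j → j < n → foata f i ≢ foata f j
  foata-≢ {i} {j} i<j j<n eq
    with f (suc i) <? prefixMax f i | f (suc j) <? prefixMax f j
  ... | yes p | yes q rewrite m≤n⇒m⊓n≡m (<⇒≤ p) | m≤n⇒m⊓n≡m (<⇒≤ q) =
    <⇒≢ (s≤s i<j) (injective-≤ (≤-trans i<j (<⇒≤ j<n)) j<n eq)
  ... | yes p | no q rewrite m≤n⇒m⊓n≡m (<⇒≤ p) | m≥n⇒m⊓n≡n (≮⇒≥ q) =
    <⇒≢ (<-≤-trans p (prefixMax-mono f (<⇒≤ i<j))) eq
  ... | no p | yes q rewrite m≥n⇒m⊓n≡n (≮⇒≥ p) | m≤n⇒m⊓n≡m (<⇒≤ q) with prefixMax-attained f i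
  ...   | k , k≤i , eq′ = <⇒≢ k<1+j (injective-≤ (≤-trans (<⇒≤ k<1+j) j<n) j<n (≡-trans eq′ eq))
    where
    k<1+j : k < suc j
    k<1+j = s≤s (≤-trans k≤i (<⇒≤ i<j))
  foata-≢ {i} {j} i<j j<n eq | no p | no q rewrite m≥n⇒m⊓n≡n (≮⇒≥ p) | m≥n⇒m⊓n≡n (≮⇒≥ q) with prefixMax-attained f i
  ...   | k , k≤i , eq′ = <⇒≢ (s≤s k≤i) (injective-≤ (≤-trans k≤i (≤-trans (<⇒≤ i<j) (<⇒≤ j<n))) (≤-trans i<j (<⇒≤ j<n))
      (≡-trans eq′ (≤-antisym (≮⇒≥ p) (≤-trans (prefixMax-upper f i<j) (≤-reflexive (sym eq))))))

  foata-Perm : Perm n (foata f)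
  foata-Perm = record
    { bounded   = λ i<n → ≤-<-trans (m⊓n≤n _ _) (prefixMax-bounded i<n)
    ; injective = inj
    }
    where
    inj : ∀ {i j} → i < n → j < n → foata f i ≡ foata f j → i ≡ j
    inj {i} {j} i<n j<n eq with <-cmp i j
    ... | tri< i<j _ _ = contradiction eq (foata-≢ i<j j<n)
    ... | tri≈ _ i≡j _ = i≡j
    ... | tri> _ _ j<i = contradiction (sym eq) (foata-≢ j<i i<n)

-- Descents of a word as excess of its Foata transform.

∘-Perm : ∀ {n f g} → Perm n f → Perm n g → Perm n (f ∘ g)
∘-Perm P Q = record
  { bounded   = bounded P ∘ bounded Q
  ; injective = λ i<n j<n → injective Q i<n j<n ∘ injective P (bounded Q i<n) (bounded Q j<n)
  }
  where open Perm

-- A permutation leaves the sum of all positions unchanged, and both sides of `∸-+-swap` are the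
-- maximum of `a` and `b`.
excess≡deficiency : ∀ {n f} → Perm n f → excess n f ≡ ∑ n (λ i → i ∸ f i)
excess≡deficiency {n} {f} P = +-cancelʳ-≡ (∑ n id) _ _ (begin
  excess n f + ∑ n id                ≡⟨ ∑-+ n _ _ ⟨
  ∑ n (λ i → (f i ∸ i) + i)          ≡⟨ ∑-cong n (λ {i} _ → ∸-+-swap (f i) i) ⟩
  ∑ n (λ i → (i ∸ f i) + f i)        ≡⟨ ∑-+ n _ _ ⟩
  ∑ n (λ i → i ∸ f i) + ∑ n f        ≡⟨ cong (∑ n (λ i → i ∸ f i) +_) (PermProperties.∑-reindex P id) ⟩
  ∑ n (λ i → i ∸ f i) + ∑ n id       ∎)
  where
  open ≡-Reasoning
  ∸-+-swap : ∀ a b → (a ∸ b) + b ≡ (b ∸ a) + a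
  ∸-+-swap zero    zero    = refl
  ∸-+-swap zero    (suc b) = sym (+-identityʳ (suc b))
  ∸-+-swap (suc a) zero    = +-identityʳ (suc a)
  ∸-+-swap (suc a) (suc b) = ≡-trans (+-suc (a ∸ b) b) (≡-trans (cong suc (∸-+-swap a b)) (sym (+-suc (b ∸ a) a)))

descentDrop : ℕ → (ℕ → ℕ) → ℕ
descentDrop n f = ∑ n λ i → f i ∸ f (suc i)

module _ {n : ℕ} {f : ℕ → ℕ} (W : Word n f) where
  open Word W

  foata∘inverse-Perm : Perm n (foata f ∘ inverse)
  foata∘inverse-Perm = ∘-Perm foata-Perm inverse-Perm

  -- After passing to deficiencies, the letter `f i` contributes
  -- `f i ∸ (f (suc i) ⊓ prefixMax f i)`. The prefix maximum is at least `f i`, so only the drop to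
  -- `f (suc i)` can count.
  excess-foata : excess n (foata f ∘ inverse) ≡ descentDrop n f
  excess-foata = begin
    excess n (foata f ∘ inverse)                   ≡⟨ excess≡deficiency foata∘inverse-Perm ⟩
    ∑ n (λ x → x ∸ foata f (inverse x))            ≡⟨ ∑-reindex (λ x → x ∸ foata f (inverse x)) ⟨
    ∑ n (λ i → f i ∸ foata f (inverse (f i)))      ≡⟨ ∑-cong n (λ {i} i<n → ≡-trans (cong (λ k → f i ∸ foata f k) (inverse∘f i<n)) (drop i)) ⟩
    descentDrop n f                                ∎
    where
    open ≡-Reasoning
    drop : ∀ i → f i ∸ foata f i ≡ f i ∸ f (suc i)
    drop i = ≡-trans (∸-distribˡ-⊓-⊔ (f i) (f (suc i)) (prefixMax f i))
      (≡-trans (cong (f i ∸ f (suc i) ⊔_) (m≤n⇒m∸n≡0 (prefixMax-upper f (≤-refl {i})))) (⊔-identityʳ _))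

  -- Reading a 321-avoiding word off its excedance data.

  -- This is `ExcedanceType` for `foata f ∘ inverse`, evaluated at the letters `f i` so that
  -- `inverse` disappears.
  record FoataType (e v : ℕ → Bool) : Set where
    field
      position : ∀ {i} → i < n → (f i <ᵇ foata f i) ≡ e (f i)
      value    : ∀ {i} → i < n → v (foata f i) ≡ e (f i)

  module FoataTypeProperties (av : Av321 n f) {e v : ℕ → Bool} (t : FoataType e v) where
    open FoataType t

    -- The excedances are the letters that are not left-to-right maxima. A maximum cannot be sent
    -- higher. After a non-maximum the word must ascend, as a descent would complete a 321 pattern
    -- with an earlier larger letter.
    e≡ : ∀ {i} → i < n → e (f i) ≡ (f i <ᵇ prefixMax f i)
    e≡ {i} i<n with m≤n⇒m<n∨m≡n (prefixMax-upper f (≤-refl {i}))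
    ... | inj₂ fi≡M = ≡-trans (sym (position i<n))
      (≡-trans (≥⇒<ᵇ≡false (≤-trans (m⊓n≤n (f (suc i)) _) (≤-reflexive (sym fi≡M))))
        (sym (≥⇒<ᵇ≡false (≤-reflexive (sym fi≡M)))))
    ... | inj₁ fi<M = ≡-trans (sym (position i<n))
      (≡-trans (<⇒<ᵇ≡true (⊓-pres-m< ascent fi<M)) (sym (<⇒<ᵇ≡true fi<M)))
      where
      ascent : f i < f (suc i)
      ascent with <-cmp (f i) (f (suc i)) | m≤n⇒m<n∨m≡n i<n
      ... | tri< p _ _ | _          = p
      ... | tri≈ _ p _ | _          = contradiction (injective-≤ (<⇒≤ i<n) i<n p) (<⇒≢ ≤-refl)
      ... | tri> _ _ p | inj₂ refl  = contradiction (<-trans p (bounded i<n)) (<-irrefl end)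
      ... | tri> _ _ p | inj₁ 1+i<n with prefixMax-attained f i
      ...   | k , k≤i , eq with m≤n⇒m<n∨m≡n k≤i
      ...     | inj₂ refl = contradiction fi<M (<-irrefl eq)
      ...     | inj₁ k<i  = ⊥-elim (av k<i ≤-refl 1+i<n (subst (f i <_) (sym eq) fi<M) p)

    v-after : ∀ {i} → i < n → f (suc i) < prefixMax f i → v (f (suc i)) ≡ e (f i)
    v-after i<n p = ≡-trans (cong v (sym (m≤n⇒m⊓n≡m (<⇒≤ p)))) (value i<n)

    -- Such a letter is a block by itself, hence a fixed point of the transform.
    v-singleton : ∀ {i} → i < n → prefixMax f i ≤ f i → prefixMax f i ≤ f (suc i) → v (f i) ≡ false
    v-singleton {i} i<n M≤fi M≤ = begin
      v (f i)                     ≡⟨ cong v (≤-antisym (prefixMax-upper f ≤-refl) M≤fi) ⟩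
      v (prefixMax f i)           ≡⟨ cong v (m≥n⇒m⊓n≡n M≤) ⟨
      v (foata f i)               ≡⟨ value i<n ⟩
      e (f i)                     ≡⟨ e≡ i<n ⟩
      (f i <ᵇ prefixMax f i)      ≡⟨ ≥⇒<ᵇ≡false M≤fi ⟩
      false                       ∎
      where open ≡-Reasoning

    -- The maximum of a block is the value of foata f at the end of the block.
    v-block : ∀ d {k} → n ∸ k ≡ d → k < n → f k < prefixMax f k → v (prefixMax f k) ≡ true
    v-block zero    eq k<n _ = contradiction k<n (≤⇒≯ (m∸n≡0⇒m≤n eq))
    v-block (suc d) {k} eq k<n fk<M with f (suc k) <? prefixMax f k
    ... | no  p = ≡-trans (cong v (sym (m≥n⇒m⊓n≡n (≮⇒≥ p))))
      (≡-trans (value k<n) (≡-trans (e≡ k<n) (<⇒<ᵇ≡true fk<M)))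
    ... | yes p = subst (λ m → v m ≡ true) M≡
      (v-block d (≡-trans (sym (pred[m∸n]≡m∸[1+n] n k)) (cong Data.Nat.pred eq)) (<prefixMax⇒<n k<n p)
        (subst (f (suc k) <_) (sym M≡) p))
      where
      M≡ : prefixMax f (suc k) ≡ prefixMax f k
      M≡ = m≥n⇒m⊔n≡m (<⇒≤ p)

    -- Counterpart of `v-singleton`: the block has a second letter, so its last letter is a
    -- non-maximum and is sent up to `f i`.
    v-top : ∀ {i} → i < n → prefixMax f i ≤ f i → f (suc i) < prefixMax f i → v (f i) ≡ true
    v-top {i} i<n M≤fi p = subst (λ m → v m ≡ true) M≡fi
      (v-block (n ∸ suc i) refl (<prefixMax⇒<n i<n p) (<-≤-trans p (m≤m⊔n _ _)))
      where
      M≡fi : prefixMax f (suc i) ≡ f i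
      M≡fi = ≡-trans (m≥n⇒m⊔n≡m (<⇒≤ p)) (≤-antisym M≤fi (prefixMax-upper f ≤-refl))

    -- Left-to-right maxima increase by definition. An inversion among non-maxima would form a 321
    -- pattern with an earlier maximum.
    same-status⇒increasing : ∀ {i j} → i < j → j < n → e (f i) ≡ e (f j) → f i < f j
    same-status⇒increasing {i} {j} i<j j<n eq with <-cmp (f i) (f j)
    ... | tri< p _ _ = p
    ... | tri≈ _ p _ = contradiction (injective (<-trans i<j j<n) j<n p) (<⇒≢ i<j)
    ... | tri> _ _ p = ⊥-elim (pattern321 (prefixMax-attained f i))
      where
      ej : e (f j) ≡ true
      ej = ≡-trans (e≡ j<n) (<⇒<ᵇ≡true (<-≤-trans p (prefixMax-upper f (<⇒≤ i<j))))
      fi<M : f i < prefixMax f i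
      fi<M = <ᵇ≡true⇒< (f i) (prefixMax f i) (≡-trans (sym (e≡ (<-trans i<j j<n))) (≡-trans eq ej))
      pattern321 : (∃ λ k → k ≤ i × f k ≡ prefixMax f i) → ⊥
      pattern321 (k , k≤i , eq′) with m≤n⇒m<n∨m≡n k≤i
      ... | inj₂ refl = <-irrefl eq′ fi<M
      ... | inj₁ k<i  = av k<i i<j j<n (subst (f i <_) (sym eq′) fi<M) p

module _ {n : ℕ} {e v : ℕ → Bool} where

  private
    module Compare {f g : ℕ → ℕ} (Wf : Word n f) (Wg : Word n g) (avf : Av321 n f) (avg : Av321 n g)
      (tf : FoataType Wf e v) (tg : FoataType Wg e v) where

      module F = FoataTypeProperties Wf avf tf
      module G = FoataTypeProperties Wg avg tg

      -- The letter `f i` occurs in `g`, but not before `i`, where the words agree. From `i` on,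
      -- letters of its status increase in `g`, so `g i` is at most `f i`.
      same-status⇒≤ : ∀ {i} → i < n → (∀ {k} → k < i → f k ≡ g k) → e (f i) ≡ e (g i) → g i ≤ f i
      same-status⇒≤ {i} i<n agree eq with Word.surjective Wg (Word.bounded Wf i<n)
      ... | j , j<n , gj≡fi with <-cmp i j
      ...   | tri≈ _ refl _ = ≤-reflexive gj≡fi
      ...   | tri< i<j _ _  = subst (g i ≤_) gj≡fi
        (<⇒≤ (G.same-status⇒increasing i<j j<n (≡-trans (sym eq) (cong e (sym gj≡fi)))))
      ...   | tri> _ _ j<i  = contradiction
        (Word.injective Wf j<n i<n (≡-trans (agree j<i) gj≡fi)) (<⇒≢ j<i)

      -- At a first difference i = p + 1 where f i is a left-to-right maximum and g i is not, either
      -- f p = g p is one too and starts blocks of different kinds, or g i continues a block in g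
      -- but would have to start the non-maxima of a block in f.
      status-differs⇒⊥ : ∀ i → i < n → (∀ {k} → k < i → f k ≡ g k) → e (f i) ≡ false → e (g i) ≡ true → ⊥
      status-differs⇒⊥ zero i<n _ _ eg = contradiction (≡-trans (sym eg) (≡-trans (G.e≡ i<n) (≥⇒<ᵇ≡false (≤-refl {g 0})))) (λ ())
      status-differs⇒⊥ (suc p) i<n agree ef eg with e (f p) in ep | <ᵇ≡true⇒< (g (suc p)) (prefixMax g (suc p)) (≡-trans (sym (G.e≡ i<n)) eg)
      ... | false | gNL = contradiction
            (≡-trans (sym v≡false) (≡-trans (cong v (agree ≤-refl)) v≡true)) (λ ())
        where
        p<n : p < n
        p<n = <-trans ≤-refl i<n
        fpLR : prefixMax f p ≤ f p
        fpLR = <ᵇ≡false⇒≥ (f p) _ (≡-trans (sym (F.e≡ p<n)) ep)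
        fLR : prefixMax f (suc p) ≤ f (suc p)
        fLR = <ᵇ≡false⇒≥ (f (suc p)) _ (≡-trans (sym (F.e≡ i<n)) ef)
        v≡false : v (f p) ≡ false
        v≡false = F.v-singleton p<n fpLR (≤-trans (m≤m⊔n _ _) fLR)
        v≡true : v (g p) ≡ true
        v≡true = G.v-top p<n (subst₂ _≤_ (prefixMax-cong p (agree ∘ s≤s)) (agree ≤-refl) fpLR) (<-prefixMax-suc g gNL)
      ... | true | gNL = elsewhere (Word.surjective Wf (Word.bounded Wg i<n))
        where
        p<n : p < n
        p<n = <-trans ≤-refl i<n
        -- The value of `v` at a non-maximum is the status of the letter before it. Hence in `f`,
        -- too, the letter `g (suc p)` must follow a non-maximum, which is `f q` below.
        vr : v (g (suc p)) ≡ true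
        vr = ≡-trans (G.v-after p<n (<-prefixMax-suc g gNL)) (≡-trans (cong e (sym (agree ≤-refl))) ep)
        elsewhere : (∃ λ j → j < n × f j ≡ g (suc p)) → ⊥
        elsewhere (j , j<n , eq) with <-cmp j (suc p)
        ... | tri< j<i _ _  = <⇒≢ j<i (Word.injective Wg j<n i<n (≡-trans (sym (agree j<i)) eq))
        ... | tri≈ _ refl _ = contradiction (≡-trans (sym ef) (≡-trans (cong e eq) eg)) (λ ())
        elsewhere (suc q , j<n , eq) | tri> _ _ (s≤s p<q) = smaller (Word.surjective Wg (Word.bounded Wf q<n))
          where
          q<n : q < n
          q<n = <-trans ≤-refl j<n
          fNL : f (suc q) < prefixMax f (suc q)
          fNL = <ᵇ≡true⇒< (f (suc q)) _ (≡-trans (sym (F.e≡ j<n)) (≡-trans (cong e eq) eg))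
          eq-q : e (f q) ≡ true
          eq-q = ≡-trans (sym (F.v-after q<n (<-prefixMax-suc f fNL))) (≡-trans (cong v eq) vr)
          fq<r : f q < g (suc p)
          fq<r = subst (f q <_) eq (F.same-status⇒increasing ≤-refl j<n
            (≡-trans eq-q (sym (≡-trans (cong e eq) eg))))
          -- The non-maximum `f q` has no place in `g`: before `suc p` the words agree, and from
          -- there on the non-maxima of `g` are at least `g (suc p)`.
          smaller : (∃ λ t → t < n × g t ≡ f q) → ⊥
          smaller (t , t<n , eq-t) with <-cmp t (suc p)
          ... | tri< t<i _ _  = <⇒≢ (<-≤-trans t<i p<q) (Word.injective Wf t<n q<n (≡-trans (agree t<i) eq-t))
          ... | tri≈ _ refl _ = <-irrefl (sym eq-t) fq<r
          ... | tri> _ _ i<t  = <-asym fq<r (subst (g (suc p) <_) eq-t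
            (G.same-status⇒increasing i<t t<n (≡-trans eg (sym (≡-trans (cong e eq-t) eq-q)))))

  -- At a first difference the statuses agree, and the letters then bound each other. Both arguments
  -- are one-sided and are applied with the words in either order.
  FoataType-injective : ∀ {f g} (Wf : Word n f) (Wg : Word n g) → Av321 n f → Av321 n g →
    FoataType Wf e v → FoataType Wg e v → ∀ {i} → i < n → f i ≡ g i
  FoataType-injective {f} {g} Wf Wg avf avg tf tg {i} = <-rec (λ i → i < n → f i ≡ g i) step i
    where
    module FG = Compare Wf Wg avf avg tf tg
    module GF = Compare Wg Wf avg avf tg tf
    step : ∀ i → (∀ {k} → k < i → k < n → f k ≡ g k) → i < n → f i ≡ g i
    step i ih i<n = cases (e (f i)) (e (g i)) refl refl
      where
      agree : ∀ {k} → k < i → f k ≡ g k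
      agree k<i = ih k<i (<-trans k<i i<n)
      same : e (f i) ≡ e (g i) → f i ≡ g i
      same eq = ≤-antisym (GF.same-status⇒≤ i<n (sym ∘ agree) (sym eq)) (FG.same-status⇒≤ i<n agree eq)
      cases : ∀ b c → e (f i) ≡ b → e (g i) ≡ c → f i ≡ g i
      cases false true  ef eg = ⊥-elim (FG.status-differs⇒⊥ i i<n agree ef eg)
      cases true  false ef eg = ⊥-elim (GF.status-differs⇒⊥ i i<n (sym ∘ agree) eg ef)
      cases true  true  ef eg = same (≡-trans ef (sym eg))
      cases false false ef eg = same (≡-trans ef (sym eg))

-- From vectors to functions on ℕ

-- Beyond its last letter a word over Fin N continues with the out-of-range letter N.
toWord : ∀ {N m} → Vec (Fin N) m → ℕ → ℕ
toWord {N} Data.Vec.[]      _       = N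
toWord     (x Data.Vec.∷ w) zero    = toℕ x
toWord     (x Data.Vec.∷ w) (suc i) = toWord w i

toWord-lookup : ∀ {N m} (w : Vec (Fin N) m) i → toℕ (lookup w i) ≡ toWord w (toℕ i)
toWord-lookup (x Data.Vec.∷ w) Data.Fin.zero    = refl
toWord-lookup (x Data.Vec.∷ w) (Data.Fin.suc i) = toWord-lookup w i

toWord-end : ∀ {N m} (w : Vec (Fin N) m) → toWord w m ≡ N
toWord-end Data.Vec.[]      = refl
toWord-end (x Data.Vec.∷ w) = toWord-end w

toWord-bounded : ∀ {N m} (w : Vec (Fin N) m) {i} → i < m → toWord w i < N
toWord-bounded (x Data.Vec.∷ w) {zero}  _         = toℕ<n x
toWord-bounded (x Data.Vec.∷ w) {suc i} (s≤s i<m) = toWord-bounded w i<m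

toWord-injective : ∀ {N m} (w z : Vec (Fin N) m) → (∀ {i} → i < m → toWord w i ≡ toWord z i) → w ≡ z
toWord-injective Data.Vec.[]      Data.Vec.[]      _  = refl
toWord-injective (x Data.Vec.∷ w) (y Data.Vec.∷ z) eq =
  cong₂ Data.Vec._∷_ (toℕ-injective (eq (s≤s z≤n))) (toWord-injective w z (eq ∘ s≤s))

toWord-surjective : ∀ {N} m (f : ℕ → ℕ) → (∀ {i} → i < m → f i < N) →
  ∃ λ (w : Vec (Fin N) m) → ∀ {i} → i < m → toWord w i ≡ f i
toWord-surjective zero    f f<N = Data.Vec.[] , λ ()
toWord-surjective (suc m) f f<N with toWord-surjective m (f ∘ suc) (f<N ∘ s≤s)
... | w , eq = fromℕ< (f<N (s≤s z≤n)) Data.Vec.∷ w ,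
  λ { {zero} _ → toℕ-fromℕ< (f<N (s≤s z≤n)) ; {suc i} (s≤s i<m) → eq i<m }

concatMap-map : {A B C : Set} (f : A → B → C) (xs : List A) (ys : List B) →
  concatMap (λ x → map (f x) ys) xs ≡ cartesianProductWith f xs ys
concatMap-map f []       ys = refl
concatMap-map f (x ∷ xs) ys = cong (map (f x) ys ++_) (concatMap-map f xs ys)

and-∈ : ∀ {bs b} → and bs ≡ true → b ∈ bs → b ≡ true
and-∈ {true ∷ bs} eq (here refl) = refl
and-∈ {true ∷ bs} eq (there b∈)  = and-∈ eq b∈

∈-and : ∀ {bs} → (∀ {b} → b ∈ bs → b ≡ true) → and bs ≡ true
∈-and {[]}     _ = refl
∈-and {b ∷ bs} h rewrite h (here refl) = ∈-and (h ∘ there)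

module _ {n : ℕ} (w : Vec (Fin n) n) where

  private
    f : ℕ → ℕ
    f = toWord w
    entry : Fin n → Fin n → Bool
    entry i j = if toℕ i <ᵇ toℕ j then not (toℕ (lookup w i) ≡ᵇ toℕ (lookup w j)) else true

  isPerm⇒Perm : isPerm w ≡ true → Perm n f
  isPerm⇒Perm isP = record { bounded = toWord-bounded w ; injective = inj }
    where
    entry≡true : ∀ i j → entry i j ≡ true
    entry≡true i j = and-∈ (≡-trans (cong and (sym (concatMap-map entry (allFin n) (allFin n)))) isP)
      (∈-cartesianProductWith⁺ entry (∈-allFin i) (∈-allFin j))
    ≡ᵇ-refl : ∀ m → (m ≡ᵇ m) ≡ true
    ≡ᵇ-refl zero    = refl
    ≡ᵇ-refl (suc m) = ≡ᵇ-refl m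
    Fin-≢ : ∀ i j → toℕ i < toℕ j → f (toℕ i) ≢ f (toℕ j)
    Fin-≢ i j i<j eq with entry≡true i j
    ... | h rewrite <⇒<ᵇ≡true i<j | toWord-lookup w i | toWord-lookup w j | eq
                  | ≡ᵇ-refl (f (toℕ j)) = contradiction h (λ ())
    distinct : ∀ {i j} → i < n → j < n → i < j → f i ≢ f j
    distinct i<n j<n i<j = subst₂ (λ i j → f i ≢ f j) (toℕ-fromℕ< i<n) (toℕ-fromℕ< j<n)
      (Fin-≢ (fromℕ< i<n) (fromℕ< j<n) (subst₂ _<_ (sym (toℕ-fromℕ< i<n)) (sym (toℕ-fromℕ< j<n)) i<j))
    inj : ∀ {i j} → i < n → j < n → f i ≡ f j → i ≡ j
    inj {i} {j} i<n j<n eq with <-cmp i j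
    ... | tri< i<j _ _ = contradiction eq (distinct i<n j<n i<j)
    ... | tri≈ _ i≡j _ = i≡j
    ... | tri> _ _ j<i = contradiction (sym eq) (distinct j<n i<n j<i)

  Perm⇒isPerm : Perm n f → isPerm w ≡ true
  Perm⇒isPerm P = ≡-trans (cong and (concatMap-map entry (allFin n) (allFin n))) (∈-and all-true)
    where
    entry≡true : ∀ i j → entry i j ≡ true
    entry≡true i j with toℕ i <ᵇ toℕ j in lt
    ... | false = refl
    ... | true with toℕ (lookup w i) ≡ᵇ toℕ (lookup w j) in eq
    ...   | false = refl
    ...   | true  = contradiction
      (Perm.injective P (toℕ<n i) (toℕ<n j) (subst₂ _≡_ (toWord-lookup w i) (toWord-lookup w j) (≡ᵇ⇒≡ _ _ (subst T (sym eq) _))))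
      (<⇒≢ (<ᵇ≡true⇒< (toℕ i) (toℕ j) lt))
    all-true : ∀ {b} → b ∈ cartesianProductWith entry (allFin n) (allFin n) → b ≡ true
    all-true b∈ with ∈-cartesianProductWith⁻ entry (allFin n) (allFin n) b∈
    ... | i , j , _ , _ , refl = entry≡true i j

  inv≡inversions : inv w ≡ inversions n f
  inv≡inversions = Σ≡∑ n λ i → Σ≡∑ n λ j → entry≡ i j
    where
    entry≡ : ∀ i j → (if toℕ i <ᵇ toℕ j then (if π[ w ] j <ᵇ π[ w ] i then 1 else 0) else 0)
      ≡ smallerAfter f (toℕ i) (toℕ j)
    entry≡ i j rewrite toWord-lookup w i | toWord-lookup w j = refl

  dexc≡excess : dexc w ≡ excess n f
  dexc≡excess = Σ≡∑ n term
    where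
    term : ∀ i → (if suc (toℕ i) <ᵇ n then (if toℕ i <ᵇ π[ w ] i then π[ w ] i ∸ toℕ i else 0) else 0)
      ≡ f (toℕ i) ∸ toℕ i
    term i rewrite toWord-lookup w i | if-<ᵇ-∸ (f (toℕ i)) (toℕ i) with suc (toℕ i) <ᵇ n in eq
    ... | true  = refl
    -- At the last index, which `dexc` leaves out, a letter below `n` has no excess.
    ... | false = sym (m≤n⇒m∸n≡0 (s≤s⁻¹ (≤-trans (toWord-bounded w (toℕ<n i)) (<ᵇ≡false⇒≥ (suc (toℕ i)) n eq))))

-- `descentDrop` has one more term than `ddes`, the step from the last letter to the closing letter,
-- and this is an ascent.
ddes≡descentDrop : ∀ {n} (w : Vec (Fin n) n) → ddes w ≡ descentDrop n (toWord w)
ddes≡descentDrop {zero}  w = refl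
ddes≡descentDrop {suc m} w = begin
  ddes w                          ≡⟨ Σ≡∑ m term ⟩
  ∑ m drop                        ≡⟨ +-identityʳ _ ⟨
  ∑ m drop + 0                    ≡⟨ cong (∑ m drop +_) last ⟨
  ∑ m drop + drop m               ≡⟨ ∑-snoc m drop ⟨
  descentDrop (suc m) (toWord w)  ∎
  where
  open ≡-Reasoning
  drop : ℕ → ℕ
  drop i = toWord w i ∸ toWord w (suc i)
  last : drop m ≡ 0
  last = m≤n⇒m∸n≡0 (≤-trans (<⇒≤ (toWord-bounded w ≤-refl)) (≤-reflexive (sym (toWord-end w))))
  term : ∀ i → (if toℕ (lookup w (Data.Fin.suc i)) <ᵇ toℕ (lookup w (Data.Fin.inject₁ i))
                then toℕ (lookup w (Data.Fin.inject₁ i)) ∸ toℕ (lookup w (Data.Fin.suc i)) else 0) ≡ drop (toℕ i)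
  term i rewrite toWord-lookup w (Data.Fin.inject₁ i) | toWord-lookup w (Data.Fin.suc i) | toℕ-inject₁ i =
    if-<ᵇ-∸ (toWord w (toℕ i)) (toWord w (suc (toℕ i)))

-- The list of bi-increasing permutations.

allVecs-Unique : ∀ n m → Unique (allVecs n m)
allVecs-Unique n zero    = [] ∷ []
allVecs-Unique n (suc m) = subst Unique (sym (concatMap-map Data.Vec._∷_ (allFin n) (allVecs n m)))
  (Unique.cartesianProductWith⁺ Data.Vec._∷_ Data.Vec.Properties.∷-injective (Unique.allFin⁺ n) (allVecs-Unique n m))

∈-allVecs : ∀ {n m} (w : Vec (Fin n) m) → w ∈ allVecs n m
∈-allVecs Data.Vec.[] = here refl
∈-allVecs {n} {suc m} (x Data.Vec.∷ w) = subst (x Data.Vec.∷ w ∈_) (sym (concatMap-map Data.Vec._∷_ (allFin n) (allVecs n m)))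
  (∈-cartesianProductWith⁺ Data.Vec._∷_ (∈-allFin x) (∈-allVecs w))

biIncreasings : ∀ n → List (Vec (Fin n) n)
biIncreasings n = filter (λ w → Data.Bool._≟_ (biIncreasing w) true) (S n)

biIncreasings-Unique : ∀ n → Unique (biIncreasings n)
biIncreasings-Unique n = Unique.filter⁺ _ (Unique.filter⁺ _ (allVecs-Unique n n))

∈-biIncreasings⁻ : ∀ {n} {w : Vec (Fin n) n} → w ∈ biIncreasings n → Perm n (toWord w) × Av321 n (toWord w)
∈-biIncreasings⁻ {n} {w} w∈ with ∈-filter⁻ (λ w → Data.Bool._≟_ (biIncreasing w) true) {xs = S n} w∈
... | w∈S , bi with ∈-filter⁻ (λ w → Data.Bool._≟_ (isPerm w) true) {xs = allVecs n n} w∈S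
...   | _ , isP = P , inversions≡excess⇒Av321 P
  (≡-trans (sym (inv≡inversions w)) (≡-trans (≡ᵇ⇒≡ _ _ (subst T (sym bi) _)) (dexc≡excess w)))
  where
  P : Perm n (toWord w)
  P = isPerm⇒Perm w isP

∈-biIncreasings⁺ : ∀ {n} {w : Vec (Fin n) n} → Perm n (toWord w) → Av321 n (toWord w) → w ∈ biIncreasings n
∈-biIncreasings⁺ {n} {w} P av = ∈-filter⁺ _ (∈-filter⁺ _ (∈-allVecs w) (Perm⇒isPerm w P)) bi
  where
  bi : biIncreasing w ≡ true
  bi with biIncreasing w in eq
  ... | true  = refl
  ... | false = ⊥-elim (subst T eq (≡⇒≡ᵇ (inv w) (dexc w)
    (≡-trans (inv≡inversions w) (≡-trans (Av321⇒inversions≡excess P av) (sym (dexc≡excess w))))))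

-- The injection and the equality of counts.

-- Links `w` to `z` by indicators `e` and `v` shared by `z` and the Foata transform of `w`. With a
-- relation in place of a function, the exchanges that lead to `z` need not be recorded.
record Matches {n : ℕ} (w z : Vec (Fin n) n) : Set where
  field
    word            : Word n (toWord w)
    avoids          : Av321 n (toWord w)
    perm            : Perm n (toWord z)
    e v             : ℕ → Bool
    foataType       : FoataType word e v
    excedanceType   : ExcedanceType n e v (toWord z)

module _ {n : ℕ} {f : ℕ → ℕ} (W : Word n f) {e v : ℕ → Bool} where
  open Word W

  FoataType⇒ExcedanceType : FoataType W e v → ExcedanceType n e v (foata f ∘ inverse)
  FoataType⇒ExcedanceType t {x} x<n =
    ≡-trans (cong (_<ᵇ foata f (inverse x)) (sym (f∘inverse x<n)))
      (≡-trans (FoataType.position t (inverse-bounded x<n)) (cong e (f∘inverse x<n))) ,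
    ≡-trans (FoataType.value t (inverse-bounded x<n)) (cong e (f∘inverse x<n))

  ExcedanceType⇒FoataType : ExcedanceType n e v (foata f ∘ inverse) → FoataType W e v
  ExcedanceType⇒FoataType t = record
    { position = λ {i} i<n → subst (λ k → (f i <ᵇ foata f k) ≡ e (f i)) (inverse∘f i<n) (proj₁ (t (bounded i<n)))
    ; value    = λ {i} i<n → subst (λ k → v (foata f k) ≡ e (f i)) (inverse∘f i<n) (proj₂ (t (bounded i<n)))
    }

ddes≡dexc : ∀ {n} {w z : Vec (Fin n) n} → Matches w z → ddes w ≡ dexc z
ddes≡dexc {n} {w} {z} M = begin
  ddes w                                          ≡⟨ ddes≡descentDrop w ⟩
  descentDrop n (toWord w)                        ≡⟨ excess-foata word ⟨
  excess n (foata (toWord w) ∘ Word.inverse word) ≡⟨ excess-determined {e = e} {v} (foata∘inverse-Perm word) perm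
                                                       (FoataType⇒ExcedanceType word {e} {v} foataType) excedanceType ⟩
  excess n (toWord z)                             ≡⟨ dexc≡excess z ⟨
  dexc z                                          ∎
  where
  open ≡-Reasoning
  open Matches M

-- Both pairs of indicators describe the excedances of the same `z`, so they agree below `n`; for
-- `v` this uses that every value is attained. The two words then have a common type.
Matches-injective : ∀ {n} {w w′ z : Vec (Fin n) n} → Matches w z → Matches w′ z → w ≡ w′
Matches-injective {n} {w} {w′} {z} M M′ = toWord-injective w w′
  (FoataType-injective M.word M′.word M.avoids M′.avoids M.foataType type)
  where
  module M  = Matches M
  module M′ = Matches M′
  e≡ : ∀ {x} → x < n → M′.e x ≡ M.e x
  e≡ x<n = ≡-trans (sym (proj₁ (M′.excedanceType x<n))) (proj₁ (M.excedanceType x<n))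
  v≡ : ∀ {y} → y < n → M.v y ≡ M′.v y
  v≡ y<n with PermProperties.surjective M.perm y<n
  ... | x , x<n , refl = ≡-trans (proj₂ (M.excedanceType x<n)) (≡-trans (sym (e≡ x<n)) (sym (proj₂ (M′.excedanceType x<n))))
  open Word M′.word
  type : FoataType M′.word M.e M.v
  type = record
    { position = λ i<n → ≡-trans (FoataType.position M′.foataType i<n) (e≡ (bounded i<n))
    ; value    = λ i<n → ≡-trans (v≡ (Perm.bounded foata-Perm i<n))
        (≡-trans (FoataType.value M′.foataType i<n) (e≡ (bounded i<n)))
    }

Matches-total : ∀ {n} {w : Vec (Fin n) n} → w ∈ biIncreasings n → ∃ λ z → z ∈ biIncreasings n × Matches w z
Matches-total {n} {w} w∈ = result (exists-Av321-of-type {e = e} {v} (foata∘inverse-Perm word) τ-type)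
  where
  word : Word n (toWord w)
  word = record { perm = proj₁ (∈-biIncreasings⁻ w∈) ; end = toWord-end w }
  τ : ℕ → ℕ
  τ = foata (toWord w) ∘ Word.inverse word
  module τ = PermProperties (foata∘inverse-Perm word)
  e v : ℕ → Bool
  e x = x <ᵇ τ x
  -- A value is an excedance value when its preimage under `τ` is an excedance.
  v y = e (τ.inverse y)
  τ-type : ExcedanceType n e v τ
  τ-type x<n = refl , cong e (τ.inverse∘f x<n)
  result : (∃ λ g → Perm n g × ExcedanceType n e v g × Av321 n g) → ∃ λ z → z ∈ biIncreasings n × Matches w z
  result (g , P , t , av) with toWord-surjective n g (Perm.bounded P)
  ... | z , z≡g = z , ∈-biIncreasings⁺ Pz avz , record
    { word = word ; avoids = proj₂ (∈-biIncreasings⁻ w∈) ; perm = Pz ; e = e ; v = v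
    ; foataType = ExcedanceType⇒FoataType word {e} {v} τ-type
    ; excedanceType = tz }
    where
    Pz : Perm n (toWord z)
    Pz = record
      { bounded   = toWord-bounded z
      ; injective = λ i<n j<n eq → Perm.injective P i<n j<n (≡-trans (sym (z≡g i<n)) (≡-trans eq (z≡g j<n)))
      }
    avz : Av321 n (toWord z)
    avz a<b b<c c<n p q = av a<b b<c c<n (subst₂ _<_ (z≡g b<n) (z≡g (<-trans a<b b<n)) p) (subst₂ _<_ (z≡g c<n) (z≡g b<n) q)
      where b<n = <-trans b<c c<n
    tz : ExcedanceType n e v (toWord z)
    tz {x} x<n = subst (λ y → (x <ᵇ y) ≡ e x × v y ≡ e x) (sym (z≡g x<n)) (t x<n)

theorem5p1 : (n : ℕ) → n ≥ 1 → (k : ℕ) →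
    countBI n dexc k ≡ countBI n ddes k
theorem5p1 n _ k = begin
  countBI n dexc k                            ≡⟨ count-∧ biIncreasing (λ w → dexc w ≡ᵇ k) (S n) ⟩
  count (λ w → dexc w ≡ᵇ k) (biIncreasings n) ≡⟨ count-transport Matches Matches-injective _ _
                                                   (cong (_≡ᵇ k) ∘ ddes≡dexc) (biIncreasings-Unique n) Matches-total ⟩
  count (λ w → ddes w ≡ᵇ k) (biIncreasings n) ≡⟨ count-∧ biIncreasing (λ w → ddes w ≡ᵇ k) (S n) ⟨
  countBI n ddes k                            ∎
  where open ≡-Reasoning
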